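{- Let $r\in\mathbb{N}$. The function $A:\mathbb{N}^r\to\mathbb{C}$ given by $$A(m_1,\ldots,m_r)= \frac1{m} \sum_{k=1}^m \gcd(k,m_1)\cdots \gcd(k,m_r),\qquad m=\operatorname{lcm}[m_1,\ldots,m_r],$$ is multiplicative as a function of $r$ variables.
   Context: $\mathbb{N}=\{1,2,\ldots\}$. A function $f:\mathbb{N}^r\to\mathbb{C}$ is called multiplicative (as a function of several variables) if it is not identically zero and $f(m_1n_1,\ldots,m_rn_r)=f(m_1,\ldots,m_r)f(n_1,\ldots,n_r)$ for all $m_1,\ldots,m_r,n_1,\ldots,n_r\in\mathbb{N}$ with $\gcd(m_1\cdots m_r,\,n_1\cdots n_r)=1$. -}

module Defs where

open import Data.Integer.Base using (+_)
open import Data.List.Base as List using (upTo)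
open import Data.Nat.Base as ℕ using (ℕ; suc; NonZero; ≢-nonZero; ≢-nonZero⁻¹)
open import Data.Nat.Divisibility using (_∣_; 0∣⇒≡0; m∣m*n; n∣m*n)
open import Data.Nat.GCD using (gcd)
open import Data.Nat.ListAction using (sum)
open import Data.Nat.LCM using (lcm; lcm-least)
open import Data.Nat.Properties using (m*n≢0)
open import Data.Product.Base using (_×_; ∃-syntax)
open import Data.Rational.Base as ℚ using (ℚ; 0ℚ; _/_)
open import Data.Vec.Base as Vec using (Vec; []; _∷_)
open import Relation.Binary.PropositionalEquality.Core using (_≡_; _≢_; subst)

record ℕ⁺ : Set where
  constructor mkℕ⁺
  field
    value        : ℕ
    .{{nonZero}} : NonZero value

open ℕ⁺ public using (value)

infixl 7 _*⁺_

_*⁺_ : ℕ⁺ → ℕ⁺ → ℕ⁺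
mkℕ⁺ m *⁺ mkℕ⁺ n = mkℕ⁺ (m ℕ.* n) {{m*n≢0 m n}}

values : ∀ {r} → Vec ℕ⁺ r → Vec ℕ r
values = Vec.map value

product : ∀ {r} → Vec ℕ r → ℕ
product = Vec.foldr′ ℕ._*_ 1

lcms : ∀ {r} → Vec ℕ r → ℕ
lcms = Vec.foldr′ lcm 1

lcm≢0 : ∀ m n .{{_ : NonZero m}} .{{_ : NonZero n}} → NonZero (lcm m n)
lcm≢0 m n = ≢-nonZero λ lcm≡0 →
  ≢-nonZero⁻¹ (m ℕ.* n) {{m*n≢0 m n}}
    (0∣⇒≡0 (subst (_∣ m ℕ.* n) lcm≡0 (lcm-least (m∣m*n {m} n) (n∣m*n m {n}))))

lcms≢0 : ∀ {r} (ms : Vec ℕ⁺ r) → NonZero (lcms (values ms))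
lcms≢0 []            = _
lcms≢0 (mkℕ⁺ m ∷ ms) = lcm≢0 m (lcms (values ms))
  where instance _ = lcms≢0 ms

-- Stated for rational values, since ℂ is not available; for a function with
-- values in ℚ ⊆ ℂ this is the same condition as for complex values.
IsMultiplicative : ∀ {r} → (Vec ℕ⁺ r → ℚ) → Set
IsMultiplicative {r} f =
  (∃[ ms ] f ms ≢ 0ℚ) ×
  (∀ (ms ns : Vec ℕ⁺ r) →
     gcd (product (values ms)) (product (values ns)) ≡ 1 →
     f (Vec.zipWith _*⁺_ ms ns) ≡ f ms ℚ.* f ns)

-- ∑[1≤k≤ m ] f k  =  f 1 + ⋯ + f m
∑[1≤k≤_]_ : ℕ → (ℕ → ℕ) → ℕ
∑[1≤k≤ m ] f = sum (List.map (λ i → f (suc i)) (upTo m))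

A : ∀ {r} → Vec ℕ⁺ r → ℚ
A ms = (+ 1 / m) {{lcms≢0 ms}} ℚ.*
       (+ (∑[1≤k≤ m ] λ k → product (Vec.map (gcd k) (values ms))) / 1)
  where
  m : ℕ
  m = lcms (values ms)

{-# OPTIONS --safe #-}

-- With M, N the least common multiples of the two coprime tuples, the product
-- of the gcds at the componentwise product of the tuples splits as F k · G k,
-- with F of period M and G of period N.  The correlation
-- T j = ∑[1≤k≤ N M ] F k · G (k + j) has periods N and M, hence is constant by
-- Bézout, so N · T 0 = ∑[1≤j≤ N ] T j = ∑[1≤k≤ N M ] F k · ∑[1≤j≤ N ] G j
-- = N · ∑[1≤k≤ M ] F k · ∑[1≤j≤ N ] G j.
module Submission where

open import Data.Integer.Base as ℤ using (+_)
import Data.Integer.Properties as ℤ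
open import Data.List.Base as List using (upTo)
open import Data.List.Properties using (map-cong; map-++; upTo-∷ʳ)
open import Data.Nat.Base using (ℕ; zero; suc; _+_; _*_; NonZero)
open import Data.Nat.Coprimality
  using (Coprime; coprime-Bézout; coprime-divisor; gcd≡1⇒coprime)
open import Data.Nat.Divisibility
open import Data.Nat.GCD
  using (gcd; gcd[m,n]∣m; gcd[m,n]∣n; gcd-greatest; gcd-zeroˡ;
         c*gcd[m,n]≡gcd[cm,cn]; module Bézout)
open import Data.Nat.LCM using (lcm; m∣lcm[m,n]; n∣lcm[m,n]; lcm-least)
open import Data.Nat.ListAction using (sum)
open import Data.Nat.ListAction.Properties using (sum-++)
open import Data.Nat.Properties
open import Algebra.Properties.CommutativeSemigroup +-commutativeSemigroup
  using () renaming (interchange to +-interchange; xy∙z≈xz∙y to +-swapʳ)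
open import Algebra.Properties.CommutativeSemigroup *-commutativeSemigroup
  using () renaming (interchange to *-interchange)
open import Data.Product.Base using (_,_)
open import Data.Rational.Base as ℚ using (ℚ; 1ℚ; _/_; fromℚᵘ; toℚᵘ)
import Data.Rational.Properties as ℚ
open import Data.Rational.Unnormalised.Base as ℚᵘ using (mkℚᵘ)
import Data.Rational.Unnormalised.Properties as ℚᵘ
open import Data.Vec.Base as Vec using (Vec; []; _∷_)
open import Function.Base using (_∘_)
open import Relation.Binary.PropositionalEquality
open import Defs

private
  variable
    k m n m′ n′ r : ℕ

-- Finite sums

-- `upTo` unfolds at the front, which shifts the summand. Splitting off the last term instead keeps
-- the summand fixed, as the inductions on the bound below require.
∑-suc : ∀ m (f : ℕ → ℕ) → ∑[1≤k≤ suc m ] f ≡ ∑[1≤k≤ m ] f + f (suc m)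
∑-suc m f = begin
  sum (List.map g (upTo (suc m)))              ≡⟨ cong (sum ∘ List.map g) (upTo-∷ʳ m) ⟨
  sum (List.map g (upTo m List.++ m List.∷ List.[]))
    ≡⟨ cong sum (map-++ g (upTo m) _) ⟩
  sum (List.map g (upTo m) List.++ g m List.∷ List.[])
    ≡⟨ sum-++ (List.map g (upTo m)) _ ⟩
  ∑[1≤k≤ m ] f + (g m + 0)                     ≡⟨ cong (_+_ (∑[1≤k≤ m ] f)) (+-identityʳ _) ⟩
  ∑[1≤k≤ m ] f + f (suc m)                     ∎
  where
  open ≡-Reasoning
  g = f ∘ suc

∑-cong : ∀ m {f g : ℕ → ℕ} → f ≗ g → ∑[1≤k≤ m ] f ≡ ∑[1≤k≤ m ] g
∑-cong m f≗g = cong sum (map-cong (f≗g ∘ suc) (upTo m))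

∑-distrib-+ : ∀ m (f g : ℕ → ℕ) →
  ∑[1≤k≤ m ] (λ k → f k + g k) ≡ ∑[1≤k≤ m ] f + ∑[1≤k≤ m ] g
∑-distrib-+ zero    f g = refl
∑-distrib-+ (suc m) f g = begin
  ∑[1≤k≤ suc m ] (λ k → f k + g k)                  ≡⟨ ∑-suc m (λ k → f k + g k) ⟩
  ∑[1≤k≤ m ] (λ k → f k + g k) + (f (suc m) + g (suc m))
    ≡⟨ cong₂ _+_ (∑-distrib-+ m f g) refl ⟩
  ∑[1≤k≤ m ] f + ∑[1≤k≤ m ] g + (f (suc m) + g (suc m))
    ≡⟨ +-interchange (∑[1≤k≤ m ] f) _ _ _ ⟩
  ∑[1≤k≤ m ] f + f (suc m) + (∑[1≤k≤ m ] g + g (suc m))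
    ≡⟨ cong₂ _+_ (∑-suc m f) (∑-suc m g) ⟨
  ∑[1≤k≤ suc m ] f + ∑[1≤k≤ suc m ] g               ∎
  where open ≡-Reasoning

*-distribˡ-∑ : ∀ c m (f : ℕ → ℕ) → c * ∑[1≤k≤ m ] f ≡ ∑[1≤k≤ m ] (λ k → c * f k)
*-distribˡ-∑ c zero    f = *-zeroʳ c
*-distribˡ-∑ c (suc m) f = begin
  c * ∑[1≤k≤ suc m ] f                      ≡⟨ cong (c *_) (∑-suc m f) ⟩
  c * (∑[1≤k≤ m ] f + f (suc m))            ≡⟨ *-distribˡ-+ c (∑[1≤k≤ m ] f) _ ⟩
  c * ∑[1≤k≤ m ] f + c * f (suc m)          ≡⟨ cong₂ _+_ (*-distribˡ-∑ c m f) refl ⟩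
  ∑[1≤k≤ m ] (λ k → c * f k) + c * f (suc m) ≡⟨ ∑-suc m (λ k → c * f k) ⟨
  ∑[1≤k≤ suc m ] (λ k → c * f k)            ∎
  where open ≡-Reasoning

*-distribʳ-∑ : ∀ c m (f : ℕ → ℕ) → ∑[1≤k≤ m ] f * c ≡ ∑[1≤k≤ m ] (λ k → f k * c)
*-distribʳ-∑ c m f = trans (*-comm _ c)
  (trans (*-distribˡ-∑ c m f) (∑-cong m λ k → *-comm c (f k)))

∑-const : ∀ m c → ∑[1≤k≤ m ] (λ _ → c) ≡ m * c
∑-const zero    c = refl
∑-const (suc m) c =
  trans (∑-suc m (λ _ → c)) (trans (cong (_+ c) (∑-const m c)) (+-comm _ c))

∑-comm : ∀ m n (f : ℕ → ℕ → ℕ) →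
  ∑[1≤k≤ m ] (λ i → ∑[1≤k≤ n ] (f i)) ≡ ∑[1≤k≤ n ] (λ j → ∑[1≤k≤ m ] (λ i → f i j))
∑-comm zero    n f = sym (trans (∑-const n 0) (*-zeroʳ n))
∑-comm (suc m) n f = begin
  ∑[1≤k≤ suc m ] (λ i → ∑[1≤k≤ n ] (f i))                ≡⟨ ∑-suc m (λ i → ∑[1≤k≤ n ] (f i)) ⟩
  ∑[1≤k≤ m ] (λ i → ∑[1≤k≤ n ] (f i)) + ∑[1≤k≤ n ] (f (suc m))
    ≡⟨ cong₂ _+_ (∑-comm m n f) refl ⟩
  ∑[1≤k≤ n ] (λ j → ∑[1≤k≤ m ] (λ i → f i j)) + ∑[1≤k≤ n ] (f (suc m))
    ≡⟨ ∑-distrib-+ n (λ j → ∑[1≤k≤ m ] (λ i → f i j)) (f (suc m)) ⟨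
  ∑[1≤k≤ n ] (λ j → ∑[1≤k≤ m ] (λ i → f i j) + f (suc m) j)
    ≡⟨ ∑-cong n (λ j → ∑-suc m (λ i → f i j)) ⟨
  ∑[1≤k≤ n ] (λ j → ∑[1≤k≤ suc m ] (λ i → f i j))        ∎
  where open ≡-Reasoning

-- The tail is written with `k + m`, so that a proof of `Periodic m f` rewrites it termwise without
-- rearrangement.
∑-+ : ∀ m n (f : ℕ → ℕ) →
  ∑[1≤k≤ m + n ] f ≡ ∑[1≤k≤ m ] f + ∑[1≤k≤ n ] (λ k → f (k + m))
∑-+ m zero    f =
  trans (cong (λ l → ∑[1≤k≤ l ] f) (+-identityʳ m)) (sym (+-identityʳ _))
∑-+ m (suc n) f = begin
  ∑[1≤k≤ m + suc n ] f                           ≡⟨ cong (λ l → ∑[1≤k≤ l ] f) (+-suc m n) ⟩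
  ∑[1≤k≤ suc (m + n) ] f                         ≡⟨ ∑-suc (m + n) f ⟩
  ∑[1≤k≤ m + n ] f + f (suc (m + n))
    ≡⟨ cong₂ _+_ (∑-+ m n f) (cong (f ∘ suc) (+-comm m n)) ⟩
  ∑[1≤k≤ m ] f + ∑[1≤k≤ n ] (λ k → f (k + m)) + f (suc n + m)
    ≡⟨ +-assoc (∑[1≤k≤ m ] f) _ _ ⟩
  ∑[1≤k≤ m ] f + (∑[1≤k≤ n ] (λ k → f (k + m)) + f (suc n + m))
    ≡⟨ cong (_+_ (∑[1≤k≤ m ] f)) (∑-suc n λ k → f (k + m)) ⟨
  ∑[1≤k≤ m ] f + ∑[1≤k≤ suc n ] (λ k → f (k + m)) ∎
  where open ≡-Reasoning

-- Periodic functions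

Periodic : ℕ → (ℕ → ℕ) → Set
Periodic m f = ∀ k → f (k + m) ≡ f k

periodic-* : ∀ {f} n → Periodic m f → Periodic (n * m) f
periodic-* {m} {f} zero    p k = cong f (+-identityʳ k)
periodic-* {m} {f} (suc n) p k = begin
  f (k + (m + n * m))  ≡⟨ cong f (+-assoc k m (n * m)) ⟨
  f (k + m + n * m)    ≡⟨ periodic-* n p (k + m) ⟩
  f (k + m)            ≡⟨ p k ⟩
  f k                  ∎
  where open ≡-Reasoning

periodic-shift : ∀ {f} j → Periodic m f → Periodic m (λ k → f (k + j))
periodic-shift {m} {f} j p k = trans (cong f (+-swapʳ k m j)) (p (k + j))

-- By Bézout some multiples of the two periods differ by 1, so adding 1 to the argument leaves the
-- value unchanged.
coprime-periods⇒constant : ∀ {f} → Coprime m n →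
  Periodic m f → Periodic n f → ∀ k → f k ≡ f 0
coprime-periods⇒constant {m} {n} {f} c p q = go
  where
  step : ∀ {m n} → Periodic m f → Periodic n f →
         ∀ x y → 1 + y * n ≡ x * m → ∀ k → f (suc k) ≡ f k
  step {m} {n} p q x y eq k = begin
    f (suc k)            ≡⟨ periodic-* y q (suc k) ⟨
    f (suc k + y * n)    ≡⟨ cong f (+-suc k (y * n)) ⟨
    f (k + (1 + y * n))  ≡⟨ cong (λ l → f (k + l)) eq ⟩
    f (k + x * m)        ≡⟨ periodic-* x p k ⟩
    f k                  ∎
    where open ≡-Reasoning
  invariant : ∀ k → f (suc k) ≡ f k
  invariant with coprime-Bézout c
  -- Over `ℕ` the identity has two forms, according to which multiple is the larger; the second
  -- swaps the two periods.
  ... | Bézout.+- x y eq = step p q x y eq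
  ... | Bézout.-+ x y eq = step q p y x eq
  go : ∀ k → f k ≡ f 0
  go zero    = refl
  go (suc k) = trans (invariant k) (go k)

-- The sum up to `j + m` is cut once after `j` and once after `m` terms. By periodicity the tail of
-- the second cut equals the sum of the first `j` terms, which then cancels.
∑-shift : ∀ m {f} → Periodic m f → ∀ j → ∑[1≤k≤ m ] (λ k → f (k + j)) ≡ ∑[1≤k≤ m ] f
∑-shift m {f} p j = +-cancelˡ-≡ (∑[1≤k≤ j ] f) _ _ (begin
  ∑[1≤k≤ j ] f + ∑[1≤k≤ m ] (λ k → f (k + j))  ≡⟨ ∑-+ j m f ⟨
  ∑[1≤k≤ j + m ] f                             ≡⟨ cong (λ l → ∑[1≤k≤ l ] f) (+-comm j m) ⟩
  ∑[1≤k≤ m + j ] f                             ≡⟨ ∑-+ m j f ⟩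
  ∑[1≤k≤ m ] f + ∑[1≤k≤ j ] (λ k → f (k + m))  ≡⟨ cong (_+_ (∑[1≤k≤ m ] f)) (∑-cong j p) ⟩
  ∑[1≤k≤ m ] f + ∑[1≤k≤ j ] f                  ≡⟨ +-comm (∑[1≤k≤ m ] f) _ ⟩
  ∑[1≤k≤ j ] f + ∑[1≤k≤ m ] f                  ∎)
  where open ≡-Reasoning

∑-periods : ∀ n m {f} → Periodic m f → ∑[1≤k≤ n * m ] f ≡ n * ∑[1≤k≤ m ] f
∑-periods zero    m     p = refl
∑-periods (suc n) m {f} p = trans (∑-+ m (n * m) f)
  (cong (_+_ _) (trans (∑-cong (n * m) p) (∑-periods n m p)))

-- This is the Chinese remainder theorem in summed form, without a bijection of residues. The factor
-- `n` put on both sides counts the shifts of `g` and is cancelled because `n` is nonzero.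
∑-*-coprime : ∀ m n .{{_ : NonZero n}} {f g : ℕ → ℕ} → Coprime m n →
  Periodic m f → Periodic n g →
  ∑[1≤k≤ m * n ] (λ k → f k * g k) ≡ ∑[1≤k≤ m ] f * ∑[1≤k≤ n ] g
∑-*-coprime m n {f} {g} c p q = *-cancelˡ-≡ _ _ n (begin
  n * ∑[1≤k≤ m * n ] (λ k → f k * g k)
    ≡⟨ cong (λ l → n * ∑[1≤k≤ l ] (λ k → f k * g k)) (*-comm m n) ⟩
  n * ∑[1≤k≤ n * m ] (λ k → f k * g k)
    ≡⟨ cong (n *_) (∑-cong (n * m) λ k → cong (λ l → f k * g l) (+-identityʳ k)) ⟨
  n * T 0                                            ≡⟨ ∑-const n (T 0) ⟨
  ∑[1≤k≤ n ] (λ _ → T 0)                             ≡⟨ ∑-cong n T-constant ⟨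
  ∑[1≤k≤ n ] T                                       ≡⟨ ∑-comm n (n * m) (λ j k → f k * g (k + j)) ⟩
  ∑[1≤k≤ n * m ] (λ k → ∑[1≤k≤ n ] (λ j → f k * g (k + j)))
    ≡⟨ ∑-cong (n * m) inner ⟩
  ∑[1≤k≤ n * m ] (λ k → f k * ∑[1≤k≤ n ] g)          ≡⟨ *-distribʳ-∑ _ (n * m) f ⟨
  ∑[1≤k≤ n * m ] f * ∑[1≤k≤ n ] g                    ≡⟨ cong (_* ∑[1≤k≤ n ] g) (∑-periods n m p) ⟩
  n * ∑[1≤k≤ m ] f * ∑[1≤k≤ n ] g                    ≡⟨ *-assoc n _ _ ⟩
  n * (∑[1≤k≤ m ] f * ∑[1≤k≤ n ] g)                  ∎)
  where
  open ≡-Reasoning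
  T : ℕ → ℕ
  T j = ∑[1≤k≤ n * m ] (λ k → f k * g (k + j))

  -- As `j` runs over a full period of `g`, so does `k + j`, and the dependence on `k` drops out of
  -- the sum.
  inner : ∀ k → ∑[1≤k≤ n ] (λ j → f k * g (k + j)) ≡ f k * ∑[1≤k≤ n ] g
  inner k = begin
    ∑[1≤k≤ n ] (λ j → f k * g (k + j))  ≡⟨ *-distribˡ-∑ (f k) n (λ j → g (k + j)) ⟨
    f k * ∑[1≤k≤ n ] (λ j → g (k + j))
      ≡⟨ cong (f k *_) (∑-cong n λ j → cong g (+-comm k j)) ⟩
    f k * ∑[1≤k≤ n ] (λ j → g (j + k))  ≡⟨ cong (f k *_) (∑-shift n q k) ⟩
    f k * ∑[1≤k≤ n ] g                  ∎

  T-periodic-n : Periodic n T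
  T-periodic-n j = ∑-cong (n * m) λ k →
    cong (f k *_) (trans (cong g (sym (+-assoc k j n))) (q (k + j)))

  summand-periodic : ∀ j → Periodic (n * m) (λ k → f k * g (k + j))
  summand-periodic j k = cong₂ _*_ (periodic-* n p k)
    (subst (λ l → Periodic l (λ i → g (i + j))) (*-comm m n)
      (periodic-* m (periodic-shift j q)) k)

  -- Since `f` has period `m`, adding `m` to `j` has the same effect as adding `m` to `k`. The sum
  -- over `k` covers a full period `n * m` of the summand, so it does not see that shift.
  T-periodic-m : Periodic m T
  T-periodic-m j = begin
    T (j + m)
      ≡⟨ ∑-cong (n * m) (λ k → cong₂ _*_ (sym (p k))
           (cong g (trans (sym (+-assoc k j m)) (+-swapʳ k j m)))) ⟩
    ∑[1≤k≤ n * m ] (λ k → f (k + m) * g (k + m + j))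
      ≡⟨ ∑-shift (n * m) (summand-periodic j) m ⟩
    T j  ∎

  T-constant : ∀ j → T j ≡ T 0
  T-constant = coprime-periods⇒constant c T-periodic-m T-periodic-n

-- Coprimality, gcd and lcm

coprime-∣ : m ∣ m′ → n ∣ n′ → Coprime m′ n′ → Coprime m n
coprime-∣ m∣m′ n∣n′ c (d∣m , d∣n) = c (∣-trans d∣m m∣m′ , ∣-trans d∣n n∣n′)

-- With `k` written as `q * n`, coprimality to `n` forces `m` to divide `q`.
coprime⇒*∣ : Coprime m n → m ∣ k → n ∣ k → m * n ∣ k
coprime⇒*∣ {m} {n} c m∣k (divides q refl) =
  *-monoˡ-∣ n (coprime-divisor c (subst (m ∣_) (*-comm q n) m∣k))

-- A divisor of `m` divides `n`, hence divides `k + n` exactly when it divides `k`.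
gcd-periodic : m ∣ n → Periodic n (λ k → gcd k m)
gcd-periodic {m} {n} m∣n k = ∣-antisym
  (gcd-greatest
    (∣m+n∣m⇒∣n (subst (gcd (k + n) m ∣_) (+-comm k n) (gcd[m,n]∣m (k + n) m))
               (∣-trans (gcd[m,n]∣n (k + n) m) m∣n))
    (gcd[m,n]∣n (k + n) m))
  (gcd-greatest
    (∣m∣n⇒∣m+n (gcd[m,n]∣m k m) (∣-trans (gcd[m,n]∣n k m) m∣n))
    (gcd[m,n]∣n k m))

-- Coprimality gives the divisibility from right to left: `gcd k m` and `gcd k n` are then coprime
-- divisors of `k`, so their product divides `k`.
gcd-*-coprime : ∀ k m n → Coprime m n → gcd k (m * n) ≡ gcd k m * gcd k n
gcd-*-coprime k m n c = ∣-antisym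
  -- The product is read as `gcd (gcd k m * k) (gcd k m * n)`, so `d` has to divide two simpler
  -- terms; `d∣gcd*n` treats the second in the same way.
  (subst (d ∣_) (sym (c*gcd[m,n]≡gcd[cm,cn] (gcd k m) k n))
    (gcd-greatest (∣n⇒∣m*n (gcd k m) d∣k) d∣gcd*n))
  (gcd-greatest
    (coprime⇒*∣ (coprime-∣ (gcd[m,n]∣n k m) (gcd[m,n]∣n k n) c)
                (gcd[m,n]∣m k m) (gcd[m,n]∣m k n))
    (*-pres-∣ (gcd[m,n]∣n k m) (gcd[m,n]∣n k n)))
  where
  d = gcd k (m * n)
  d∣k : d ∣ k
  d∣k = gcd[m,n]∣m k (m * n)
  d∣gcd*n : d ∣ gcd k m * n
  d∣gcd*n = subst (d ∣_)
    (trans (sym (c*gcd[m,n]≡gcd[cm,cn] n k m)) (*-comm n (gcd k m)))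
    (gcd-greatest (∣n⇒∣m*n n d∣k)
                  (subst (d ∣_) (*-comm m n) (gcd[m,n]∣n k (m * n))))

-- Tuples

gcds : ∀ {r} → Vec ℕ r → ℕ → ℕ
gcds ms k = product (Vec.map (gcd k) ms)

values-zipWith-*⁺ : (ms ns : Vec ℕ⁺ r) →
  values (Vec.zipWith _*⁺_ ms ns) ≡ Vec.zipWith _*_ (values ms) (values ns)
values-zipWith-*⁺ []       []       = refl
values-zipWith-*⁺ (m ∷ ms) (n ∷ ns) = cong (_ ∷_) (values-zipWith-*⁺ ms ns)

-- Multiplicativity is stated with products, whereas the periods are least common multiples; this
-- carries coprimality from the former to the latter.
lcms∣product : (ms : Vec ℕ r) → lcms ms ∣ product ms
lcms∣product []       = ∣-refl
lcms∣product (m ∷ ms) =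
  lcm-least {m} (m∣m*n (product ms)) (∣n⇒∣m*n m (lcms∣product ms))

lcm-mono-∣ : m ∣ m′ → n ∣ n′ → lcm m n ∣ lcm m′ n′
lcm-mono-∣ {m} {m′} {n} {n′} m∣m′ n∣n′ = lcm-least {m} {n}
  (∣-trans m∣m′ (m∣lcm[m,n] m′ n′)) (∣-trans n∣n′ (n∣lcm[m,n] m′ n′))

lcms∣lcms-zipWith-*ˡ : (ms ns : Vec ℕ r) → lcms ms ∣ lcms (Vec.zipWith _*_ ms ns)
lcms∣lcms-zipWith-*ˡ []       []       = ∣-refl
lcms∣lcms-zipWith-*ˡ (m ∷ ms) (n ∷ ns) =
  lcm-mono-∣ {m} (m∣m*n n) (lcms∣lcms-zipWith-*ˡ ms ns)

lcms∣lcms-zipWith-*ʳ : (ms ns : Vec ℕ r) → lcms ns ∣ lcms (Vec.zipWith _*_ ms ns)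
lcms∣lcms-zipWith-*ʳ []       []       = ∣-refl
lcms∣lcms-zipWith-*ʳ (m ∷ ms) (n ∷ ns) =
  lcm-mono-∣ {n} (n∣m*n m) (lcms∣lcms-zipWith-*ʳ ms ns)

lcms-zipWith-*∣ : (ms ns : Vec ℕ r) → lcms (Vec.zipWith _*_ ms ns) ∣ lcms ms * lcms ns
lcms-zipWith-*∣ []       []       = ∣-refl
lcms-zipWith-*∣ (m ∷ ms) (n ∷ ns) = lcm-least
  (*-pres-∣ (m∣lcm[m,n] m (lcms ms)) (m∣lcm[m,n] n (lcms ns)))
  (∣-trans (lcms-zipWith-*∣ ms ns)
    (*-pres-∣ (n∣lcm[m,n] m (lcms ms)) (n∣lcm[m,n] n (lcms ns))))

coprime-lcms : (ms ns : Vec ℕ r) →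
  Coprime (product ms) (product ns) → Coprime (lcms ms) (lcms ns)
coprime-lcms ms ns = coprime-∣ (lcms∣product ms) (lcms∣product ns)

-- Both least common multiples divide the left side; being coprime, so does their product.
lcms-zipWith-* : (ms ns : Vec ℕ r) → Coprime (product ms) (product ns) →
  lcms (Vec.zipWith _*_ ms ns) ≡ lcms ms * lcms ns
lcms-zipWith-* ms ns c = ∣-antisym (lcms-zipWith-*∣ ms ns)
  (coprime⇒*∣ (coprime-lcms ms ns c)
    (lcms∣lcms-zipWith-*ˡ ms ns) (lcms∣lcms-zipWith-*ʳ ms ns))

gcds-zipWith-* : (ms ns : Vec ℕ r) → Coprime (product ms) (product ns) →
  ∀ k → gcds (Vec.zipWith _*_ ms ns) k ≡ gcds ms k * gcds ns k
gcds-zipWith-* []       []       c k = refl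
gcds-zipWith-* (m ∷ ms) (n ∷ ns) c k = trans
  (cong₂ _*_
    (gcd-*-coprime k m n (coprime-∣ (m∣m*n (product ms)) (m∣m*n (product ns)) c))
    (gcds-zipWith-* ms ns (coprime-∣ (n∣m*n m) (n∣m*n n) c) k))
  (*-interchange (gcd k m) _ _ _)

-- Allowing any multiple `n` of the lcm keeps `n` fixed in the induction, where the lcm of the tail
-- may be smaller.
gcds-periodic : (ms : Vec ℕ r) → lcms ms ∣ n → Periodic n (gcds ms)
gcds-periodic []       _     k = refl
gcds-periodic (m ∷ ms) lcm∣n k = cong₂ _*_
  (gcd-periodic (∣-trans (m∣lcm[m,n] m (lcms ms)) lcm∣n) k)
  (gcds-periodic ms (∣-trans (n∣lcm[m,n] m (lcms ms)) lcm∣n) k)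

∑gcds : ∀ {r} → Vec ℕ r → ℕ
∑gcds ms = ∑[1≤k≤ lcms ms ] gcds ms

∑gcds-zipWith-* : (ms ns : Vec ℕ r) .{{_ : NonZero (lcms ns)}} →
  Coprime (product ms) (product ns) →
  ∑gcds (Vec.zipWith _*_ ms ns) ≡ ∑gcds ms * ∑gcds ns
∑gcds-zipWith-* ms ns c = begin
  ∑gcds (Vec.zipWith _*_ ms ns)
    ≡⟨ cong (λ l → ∑[1≤k≤ l ] gcds (Vec.zipWith _*_ ms ns)) (lcms-zipWith-* ms ns c) ⟩
  ∑[1≤k≤ lcms ms * lcms ns ] gcds (Vec.zipWith _*_ ms ns)
    ≡⟨ ∑-cong (lcms ms * lcms ns) (gcds-zipWith-* ms ns c) ⟩
  ∑[1≤k≤ lcms ms * lcms ns ] (λ k → gcds ms k * gcds ns k)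
    ≡⟨ ∑-*-coprime (lcms ms) (lcms ns) (coprime-lcms ms ns c)
         (gcds-periodic ms ∣-refl) (gcds-periodic ns ∣-refl) ⟩
  ∑gcds ms * ∑gcds ns ∎
  where open ≡-Reasoning

-- Rational averages

-- `_/_` reduces to lowest terms, so the two sides do not agree by computation. For unnormalised
-- fractions the product has this form by definition, and `toℚᵘ` is injective.
/-*-/ : ∀ p q m n .{{_ : NonZero m}} .{{_ : NonZero n}} →
  ((p ℤ.* q) / (m * n)) {{m*n≢0 m n}} ≡ (p / m) ℚ.* (q / n)
/-*-/ p q (suc m) (suc n) = ℚ.toℚᵘ-injective (begin
  toℚᵘ (fromℚᵘ (u ℚᵘ.* v))             ≈⟨ ℚ.toℚᵘ-fromℚᵘ (u ℚᵘ.* v) ⟩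
  u ℚᵘ.* v
    ≈⟨ ℚᵘ.*-cong (ℚ.toℚᵘ-fromℚᵘ u) (ℚ.toℚᵘ-fromℚᵘ v) ⟨
  toℚᵘ (fromℚᵘ u) ℚᵘ.* toℚᵘ (fromℚᵘ v) ≈⟨ ℚ.toℚᵘ-homo-* (fromℚᵘ u) (fromℚᵘ v) ⟨
  toℚᵘ (fromℚᵘ u ℚ.* fromℚᵘ v)         ∎)
  where
  open import Relation.Binary.Reasoning.Setoid ℚᵘ.≃-setoid
  u = mkℚᵘ p m
  v = mkℚᵘ q n

-- `A ms` unfolds to this expression at `lcms (values ms)` and `∑gcds (values ms)`.
average : ∀ m .{{_ : NonZero m}} → ℕ → ℚ
average m s = (+ 1 / m) ℚ.* (+ s / 1)

-- With the denominators as variables and their nonzero proofs irrelevant, matching on `refl`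
-- changes a denominator without transporting its proof.
average-cong : ∀ {m n s t} .{{_ : NonZero m}} .{{_ : NonZero n}} →
  m ≡ n → s ≡ t → average m s ≡ average n t
average-cong refl refl = refl

average-* : ∀ m n s t .{{_ : NonZero m}} .{{_ : NonZero n}} →
  average (m * n) {{m*n≢0 m n}} (s * t) ≡ average m s ℚ.* average n t
average-* m n s t = begin
  (+ 1 / (m * n)) {{m*n≢0 m n}} ℚ.* (+ (s * t) / 1)
    ≡⟨ cong₂ ℚ._*_ (/-*-/ (+ 1) (+ 1) m n)
         (trans (cong (_/ 1) (ℤ.pos-* s t)) (/-*-/ (+ s) (+ t) 1 1)) ⟩
  (+ 1 / m) ℚ.* (+ 1 / n) ℚ.* ((+ s / 1) ℚ.* (+ t / 1))
    ≡⟨ interchange (+ 1 / m) (+ 1 / n) (+ s / 1) (+ t / 1) ⟩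
  average m s ℚ.* average n t ∎
  where
  open ≡-Reasoning
  open import Algebra.Bundles using (CommutativeMonoid)
  open import Algebra.Properties.CommutativeSemigroup
    (CommutativeMonoid.commutativeSemigroup ℚ.*-1-commutativeMonoid) using (interchange)

-- Multiplicativity and non-vanishing of the average

A-zipWith-*⁺ : (ms ns : Vec ℕ⁺ r) →
  Coprime (product (values ms)) (product (values ns)) →
  A (Vec.zipWith _*⁺_ ms ns) ≡ A ms ℚ.* A ns
A-zipWith-*⁺ ms ns c = trans
  (average-cong
    (trans (cong lcms eq) (lcms-zipWith-* (values ms) (values ns) c))
    (trans (cong ∑gcds eq)
           (∑gcds-zipWith-* (values ms) (values ns) c)))
  (average-* (lcms (values ms)) (lcms (values ns)) (∑gcds (values ms)) (∑gcds (values ns)))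
  where
  eq = values-zipWith-*⁺ ms ns
  instance
    _ = lcms≢0 (Vec.zipWith _*⁺_ ms ns)
    _ = lcms≢0 ms
    _ = lcms≢0 ns
    _ = m*n≢0 (lcms (values ms)) (lcms (values ns))

gcds-1 : (ms : Vec ℕ r) → gcds ms 1 ≡ 1
gcds-1 []       = refl
gcds-1 (m ∷ ms) = cong₂ _*_ (gcd-zeroˡ m) (gcds-1 ms)

ones : ∀ r → Vec ℕ⁺ r
ones r = Vec.replicate r (mkℕ⁺ 1)

lcms-ones : ∀ r → lcms (values (ones r)) ≡ 1
lcms-ones zero    = refl
lcms-ones (suc r) = cong (lcm 1) (lcms-ones r)

-- This shows that `A` is not identically zero: the lcm is 1, so only the term at `k = 1` occurs.
A-ones : ∀ r → A (ones r) ≡ 1ℚ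
A-ones r = average-cong {{lcms≢0 (ones r)}} (lcms-ones r) (begin
  ∑[1≤k≤ lcms (values (ones r)) ] f  ≡⟨ cong (λ l → ∑[1≤k≤ l ] f) (lcms-ones r) ⟩
  f 1 + 0                            ≡⟨ cong (_+ 0) (gcds-1 (values (ones r))) ⟩
  1                                  ∎)
  where
  open ≡-Reasoning
  f = gcds (values (ones r))

corollary13 : (r : ℕ) .{{_ : NonZero r}} → IsMultiplicative (A {r})
corollary13 r =
  (ones r , λ A≡0 → ℚ.1≢0 (trans (sym (A-ones r)) A≡0)) ,
  λ ms ns gcd≡1 → A-zipWith-*⁺ ms ns (gcd≡1⇒coprime gcd≡1)
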